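{- Let $X,Y$ be finitely supported subsets of invariant sets. (1) $X$ is FSM Dedekind infinite if and only if there exists a finitely supported injective map $\mathbb N\to X$ (with $\mathbb N$ carrying the trivial action). (4) If $X$ contains no infinite uniformly supported subset, then $X$ is not FSM Dedekind infinite. (6) If neither $X$ nor $Y$ is FSM Dedekind infinite, then $X\times Y$ is not FSM Dedekind infinite. (7) If neither $X$ nor $Y$ is FSM Dedekind infinite, then $X+Y$ is not FSM Dedekind infinite.
   Context: Framework (FSM). Work in ZF with a fixed infinite set $A$ of atoms; $S_A$ is the group of bijections of $A$ fixing all but finitely many atoms; $Fix(S)$ is the set of $\pi\in S_A$ fixing each element of $S\subseteq A$; $S$ supports $x$ if $\pi\cdot x=x$ for all $\pi\in Fix(S)$. An invariant set is an $S_A$-set all of whose elements have finite supports; subsets carry $\pi\star Z=\{\pi\cdot z:z\in Z\}$ and a subset is finitely supported if it has a finite support under this action. Ordinary sets such as $\mathbb N$ carry the trivial action. Products carry $\pi\cdot(x,y)=(\pi\cdot x,\pi\cdot y)$; $X+Y=\{(0,x):x\in X\}\cup\{(1,y):y\in Y\}$ with $\pi\cdot(i,z)=(i,\pi\cdot z)$. A function is finitely supported if there is a finite $S$ such that for all $\pi\in Fix(S)$ and $x$ in the domain, $\pi$ preserves domain and codomain and $f(\pi\cdot x)=\pi\cdot f(x)$. A subset is uniformly supported if all its elements are supported by one common finite set of atoms. $X$ is FSM Dedekind infinite if there is a finitely supported injection from $X$ onto a finitely supported proper subset of $X$. -}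

module Defs where

open import Algebra.Bundles using (Group)
open import Data.List using (List; []; _++_)
open import Data.List.Membership.Propositional using (_∈_; _∉_)
open import Data.List.Membership.Propositional.Properties using (∈-++⁺ˡ; ∈-++⁺ʳ)
import Data.List.Membership.Setoid as SetoidMembership
open import Data.Nat using (ℕ)
open import Data.Product using (Σ; Σ-syntax; _×_; _,_; proj₁; proj₂)
open import Data.Product.Relation.Binary.Pointwise.NonDependent using (_×ₛ_)
open import Data.Sum using (_⊎_; inj₁; inj₂; [_,_])
import Data.Sum as Sum
open import Data.Sum.Relation.Binary.Pointwise using (_⊎ₛ_; inj₁; inj₂)
open import Function using (_∘_)
open import Function.Bundles using (Func; Injection; Bijection; Inverse; _↔_; _⇔_)
open import Function.Construct.Composition using (_↔-∘_)
open import Function.Construct.Identity using (↔-id)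
open import Function.Construct.Symmetry using (↔-sym)
open import Level using (Level; _⊔_; 0ℓ) renaming (suc to lsuc)
open import Relation.Binary.Bundles using (Setoid)
import Relation.Binary.Construct.On as On
open import Relation.Binary.PropositionalEquality using (_≡_; refl; sym; trans; cong; setoid)
open import Relation.Nullary using (¬_)
open import Relation.Unary using (Pred; U; _⊆_; _⊂_; _≐_; _⟨×⟩_; _⟨⊎⟩_)

private
  variable
    a c ℓ ℓ₁ ℓ₂ : Level
    A : Set a

Finite : (S : Setoid c ℓ) → Pred (Setoid.Carrier S) ℓ₁ → Set (c ⊔ ℓ ⊔ ℓ₁)
Finite S P = Σ[ xs ∈ List (Setoid.Carrier S) ] (∀ x → P x ⇔ (x ∈ₛ xs))
  where open SetoidMembership S renaming (_∈_ to _∈ₛ_)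

Infinite : (S : Setoid c ℓ) → Pred (Setoid.Carrier S) ℓ₁ → Set (c ⊔ ℓ ⊔ ℓ₁)
Infinite S P = ¬ Finite S P

record FinPerm (A : Set a) : Set a where
  field
    perm     : A ↔ A
    moved    : List A
    fixesOff : ∀ {x} → x ∉ moved → Inverse.to perm x ≡ x

  _⟨$⟩_ : A → A
  _⟨$⟩_ = Inverse.to perm

open FinPerm using (_⟨$⟩_)

private
  idₚ : FinPerm A
  idₚ {A = A} = record { perm = ↔-id A ; moved = [] ; fixesOff = λ _ → refl }

  _∘ₚ_ : FinPerm A → FinPerm A → FinPerm A
  π ∘ₚ ρ = record
    { perm     = FinPerm.perm π ↔-∘ FinPerm.perm ρ
    ; moved    = FinPerm.moved π ++ FinPerm.moved ρ
    ; fixesOff = λ x∉ →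
        trans (cong (π ⟨$⟩_) (FinPerm.fixesOff ρ (x∉ ∘ ∈-++⁺ʳ (FinPerm.moved π))))
              (FinPerm.fixesOff π (x∉ ∘ ∈-++⁺ˡ))
    }

  _⁻¹ₚ : FinPerm A → FinPerm A
  π ⁻¹ₚ = record
    { perm     = ↔-sym (FinPerm.perm π)
    ; moved    = FinPerm.moved π
    ; fixesOff = λ x∉ → Inverse.inverseʳ (FinPerm.perm π) (sym (FinPerm.fixesOff π x∉))
    }

-- The group S_A.  Two elements are equal when they agree at every atom; the
-- list of possibly moved atoms is only a witness.
S[_] : (A : Set a) → Group a a
S[ A ] = record
  { Carrier = FinPerm A
  ; _≈_     = λ π ρ → ∀ x → π ⟨$⟩ x ≡ ρ ⟨$⟩ x
  ; _∙_     = _∘ₚ_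
  ; ε       = idₚ
  ; _⁻¹     = _⁻¹ₚ
  ; isGroup = record
    { isMonoid = record
      { isSemigroup = record
        { isMagma = record
          { isEquivalence = record
            { refl  = λ _ → refl
            ; sym   = λ p x → sym (p x)
            ; trans = λ p q x → trans (p x) (q x)
            }
          ; ∙-cong = λ {π} {π′} {ρ} {ρ′} p q x →
              trans (cong (π ⟨$⟩_) (q x)) (p (ρ′ ⟨$⟩ x))
          }
        ; assoc = λ _ _ _ _ → refl
        }
      ; identity = (λ _ _ → refl) , (λ _ _ → refl)
      }
    ; inverse = (λ π x → Inverse.inverseʳ (FinPerm.perm π) refl)
              , (λ π x → Inverse.inverseˡ (FinPerm.perm π) refl)
    ; ⁻¹-cong = λ {π} {ρ} p x →
        Inverse.inverseʳ (FinPerm.perm π)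
          (sym (trans (p _) (Inverse.inverseˡ (FinPerm.perm ρ) refl)))
    }
  }

Fix : List A → Pred (FinPerm A) _
Fix S π = ∀ {x} → x ∈ S → π ⟨$⟩ x ≡ x

Fix-++ˡ : ∀ {A : Set a} {S T : List A} {π} → Fix (S ++ T) π → Fix S π
Fix-++ˡ fix x∈ = fix (∈-++⁺ˡ x∈)

Fix-++ʳ : ∀ {A : Set a} (S : List A) {T π} → Fix (S ++ T) π → Fix T π
Fix-++ʳ S fix x∈ = fix (∈-++⁺ʳ S x∈)

-- The underlying set is a setoid, so that quotients are included.  A finite set
-- of atoms is given by a list enumerating it.
record InvariantSet (A : Set a) (ℓ : Level) : Set (a ⊔ lsuc ℓ) where
  open Group S[ A ] using (_∙_; ε) renaming (_≈_ to _≈ₚ_)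
  infixr 7 _·_
  field
    setoidOf : Setoid ℓ ℓ
  open Setoid setoidOf public renaming (refl to ≈-refl; sym to ≈-sym; trans to ≈-trans)
  field
    _·_    : FinPerm A → Carrier → Carrier
    ·-cong : ∀ {π ρ x y} → π ≈ₚ ρ → x ≈ y → π · x ≈ ρ · y
    ·-id   : ∀ x → ε · x ≈ x
    ·-∘    : ∀ π ρ x → (π ∙ ρ) · x ≈ π · (ρ · x)

  Supports : List A → Carrier → Set (a ⊔ ℓ)
  Supports S x = ∀ π → Fix S π → π · x ≈ x

  field
    finiteSupport : ∀ x → Σ[ S ∈ List A ] Supports S x

  _⋆_ : FinPerm A → Pred Carrier ℓ → Pred Carrier ℓ
  (π ⋆ Z) y = Σ[ z ∈ Carrier ] (Z z × y ≈ π · z)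

open InvariantSet using (Carrier; setoidOf)

trivial : (A : Set a) → Setoid ℓ ℓ → InvariantSet A ℓ
trivial A S = record
  { setoidOf      = S
  ; _·_           = λ _ x → x
  ; ·-cong        = λ _ p → p
  ; ·-id          = λ _ → S.refl
  ; ·-∘           = λ _ _ _ → S.refl
  ; finiteSupport = λ _ → [] , λ _ _ → S.refl
  }
  where module S = Setoid S

infixr 2 _×ᵢ_
_×ᵢ_ : InvariantSet A ℓ → InvariantSet A ℓ → InvariantSet A ℓ
V ×ᵢ W = record
  { setoidOf      = setoidOf V ×ₛ setoidOf W
  ; _·_           = λ π (x , y) → (π V.· x) , (π W.· y)
  ; ·-cong        = λ e (p , q) → V.·-cong e p , W.·-cong e q
  ; ·-id          = λ (x , y) → V.·-id x , W.·-id y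
  ; ·-∘           = λ π ρ (x , y) → V.·-∘ π ρ x , W.·-∘ π ρ y
  ; finiteSupport = λ (x , y) →
      let (S , sx) = V.finiteSupport x
          (T , sy) = W.finiteSupport y
      in S ++ T , λ π fix → sx π (Fix-++ˡ {π = π} fix) , sy π (Fix-++ʳ S {π = π} fix)
  }
  where
  module V = InvariantSet V
  module W = InvariantSet W

infixr 1 _⊎ᵢ_
_⊎ᵢ_ : InvariantSet A ℓ → InvariantSet A ℓ → InvariantSet A ℓ
V ⊎ᵢ W = record
  { setoidOf      = setoidOf V ⊎ₛ setoidOf W
  ; _·_           = λ π → Sum.map (π V.·_) (π W.·_)
  ; ·-cong        = λ { e (inj₁ p) → inj₁ (V.·-cong e p) ; e (inj₂ p) → inj₂ (W.·-cong e p) }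
  ; ·-id          = λ { (inj₁ x) → inj₁ (V.·-id x) ; (inj₂ y) → inj₂ (W.·-id y) }
  ; ·-∘           = λ { π ρ (inj₁ x) → inj₁ (V.·-∘ π ρ x) ; π ρ (inj₂ y) → inj₂ (W.·-∘ π ρ y) }
  ; finiteSupport = λ
      { (inj₁ x) → let (S , s) = V.finiteSupport x in S , λ π fix → inj₁ (s π fix)
      ; (inj₂ y) → let (S , s) = W.finiteSupport y in S , λ π fix → inj₂ (s π fix)
      }
  }
  where
  module V = InvariantSet V
  module W = InvariantSet W

record Subset {A : Set a} (V : InvariantSet A ℓ) : Set (lsuc ℓ) where
  open InvariantSet V using (_≈_)
  field
    mem      : Pred (Carrier V) ℓ
    respects : ∀ {x y} → x ≈ y → mem x → mem y

  asSetoid : Setoid ℓ ℓ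
  asSetoid = On.setoid {B = Σ (Carrier V) mem} (setoidOf V) proj₁

open Subset using (mem; asSetoid)

whole : (V : InvariantSet A 0ℓ) → Subset V
whole V = record { mem = U ; respects = λ _ _ → _ }

infixr 2 _×ₛᵤᵦ_
_×ₛᵤᵦ_ : {V W : InvariantSet A ℓ} → Subset V → Subset W → Subset (V ×ᵢ W)
X ×ₛᵤᵦ Y = record
  { mem      = mem X ⟨×⟩ mem Y
  ; respects = λ (p , q) (x∈ , y∈) → Subset.respects X p x∈ , Subset.respects Y q y∈
  }

infixr 1 _⊎ₛᵤᵦ_
_⊎ₛᵤᵦ_ : {V W : InvariantSet A ℓ} → Subset V → Subset W → Subset (V ⊎ᵢ W)
X ⊎ₛᵤᵦ Y = record
  { mem      = mem X ⟨⊎⟩ mem Y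
  ; respects = λ { (inj₁ p) → Subset.respects X p ; (inj₂ p) → Subset.respects Y p }
  }

module _ {A : Set a} {V : InvariantSet A ℓ} where
  open InvariantSet V

  FinitelySupported : Subset V → Set (a ⊔ ℓ)
  FinitelySupported X = Σ[ S ∈ List A ] (∀ π → Fix S π → π ⋆ mem X ≐ mem X)

  UniformlySupported : Subset V → Set (a ⊔ ℓ)
  UniformlySupported X = Σ[ S ∈ List A ] (∀ {x} → mem X x → Supports S x)

module _ {A : Set a} {V : InvariantSet A ℓ₁} {W : InvariantSet A ℓ₂} where
  private
    module V = InvariantSet V
    module W = InvariantSet W

  FinitelySupportedFunction : (X : Subset V) (Y : Subset W) →
                              Func (asSetoid X) (asSetoid Y) → Set (a ⊔ ℓ₁ ⊔ ℓ₂)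
  FinitelySupportedFunction X Y f =
    Σ[ S ∈ List A ] (∀ π → Fix S π →
      Σ[ π·X ∈ (∀ {x} → mem X x → mem X (π V.· x)) ]
      (∀ {y} → mem Y y → mem Y (π W.· y)) ×
      (∀ x (x∈X : mem X x) →
        proj₁ (to (π V.· x , π·X x∈X)) W.≈ π W.· proj₁ (to (x , x∈X))))
    where open Func f using (to)

  FSInjection : Subset V → Subset W → Set (a ⊔ ℓ₁ ⊔ ℓ₂)
  FSInjection X Y =
    Σ[ f ∈ Injection (asSetoid X) (asSetoid Y) ]
      FinitelySupportedFunction X Y (Injection.function f)

-- An injection from X onto Z is a bijection X → Z.
FSDedekindInfinite : {V : InvariantSet A ℓ} → Subset V → Set _
FSDedekindInfinite {V = V} X =
  Σ[ Z ∈ Subset V ] FinitelySupported Z × mem Z ⊂ mem X ×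
    (Σ[ f ∈ Bijection (asSetoid X) (asSetoid Z) ]
      FinitelySupportedFunction X Z (Injection.function (Bijection.injection f)))

ℕᵢ : (A : Set a) → InvariantSet A 0ℓ
ℕᵢ A = trivial A (setoid ℕ)

{-# OPTIONS --safe #-}

-- X is FSM Dedekind infinite exactly when some injective sequence of elements
-- of X is supported, term by term, by one finite set of atoms.  Given
-- f : X → Z ⊂ X and x ∈ X ∖ Z, the sequence fⁿ(x) is supported by the union of
-- supports of f and x; given a sequence s, the map sending s n to s (n + 1) and
-- fixing everything else is a bijection from X onto X ∖ {s 0}.  The range of
-- such a sequence is infinite and uniformly supported, and a support is
-- inherited by coordinates and by subsequences, so products and sums reduce to
-- the infinite pigeonhole principle.
module Submission where

open import Defs
open import Axiom.ExcludedMiddle using (ExcludedMiddle)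
open import Algebra.Bundles using (Group)
open import Data.Fin using (toℕ)
import Data.Fin.Properties as Fin
open import Data.List using (List; _++_)
import Data.List.Membership.Setoid as SetoidMembership
import Data.List.Membership.Setoid.Properties as SetoidMembershipₚ
open import Data.List.Relation.Unary.Any using (index)
open import Data.Nat using (ℕ; zero; suc; _≤_; _<_; s≤s) renaming (_⊔_ to _⊔ₙ_)
open import Data.Nat.Properties
  using (≤-refl; ≤-trans; <⇒≤; <⇒≢; ≮⇒≥; <-cmp; suc-injective; m≤m⊔n; m≤n⊔m; m≤n⇒m<n∨m≡n)
open import Data.Product using (Σ-syntax; _×_; _,_; proj₁; proj₂)
open import Data.Sum using (_⊎_; inj₁; inj₂; [_,_])
import Data.Sum as Sum
open import Data.Sum.Relation.Binary.Pointwise using (inj₁; inj₂; drop-inj₁; drop-inj₂)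
open import Data.Unit using (tt)
open import Function using (_∘_)
open import Function.Bundles using (Injection; Bijection; _⇔_; mk⇔; Equivalence)
open import Level using (Level; _⊔_; Lift; lift; lower)
open import Relation.Binary.Definitions using (tri<; tri≈; tri>)
open import Relation.Binary.PropositionalEquality
  using (_≡_; refl; sym; cong; subst; subst₂; setoid)
open import Relation.Nullary using (¬_; yes; no; contradiction)
open import Relation.Nullary.Decidable using (map′; decidable-stable)
open import Relation.Unary using (Pred; U; _⊆_; _∪_)

private
  variable
    a ℓ p : Level
    A : Set a

-- Every case distinction below is on a proposition of level `ℓ`, while the theorem assumes excluded
-- middle at `a ⊔ ℓ`.
lower-em : ∀ a {ℓ} → ExcludedMiddle (a ⊔ ℓ) → ExcludedMiddle ℓ
lower-em a em {P} = map′ lower lift (em {Lift a P})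

-- Subsequences and the infinite pigeonhole principle

InfinitelyOften : Pred ℕ p → Set p
InfinitelyOften P = ∀ N → Σ[ n ∈ ℕ ] N ≤ n × P n

StrictlyIncreasing : (ℕ → ℕ) → Set
StrictlyIncreasing h = ∀ {i j} → i < j → h i < h j

step⇒strictlyIncreasing : (h : ℕ → ℕ) → (∀ k → h k < h (suc k)) → StrictlyIncreasing h
step⇒strictlyIncreasing h step {i} {suc j} (s≤s i≤j) with m≤n⇒m<n∨m≡n i≤j
... | inj₁ i<j  = ≤-trans (step⇒strictlyIncreasing h step i<j) (<⇒≤ (step j))
... | inj₂ refl = step j

strictlyIncreasing⇒injective : (h : ℕ → ℕ) → StrictlyIncreasing h → ∀ {i j} → h i ≡ h j → i ≡ j
strictlyIncreasing⇒injective h h< {i} {j} eq with <-cmp i j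
... | tri< i<j _ _ = contradiction eq (<⇒≢ (h< i<j))
... | tri≈ _ i≡j _ = i≡j
... | tri> _ _ j<i = contradiction (sym eq) (<⇒≢ (h< j<i))

-- R N n may constrain n by the terms chosen so far, all of which lie below N.
recursive-choice : {R : ℕ → Pred ℕ p} → (∀ N → Σ[ n ∈ ℕ ] N ≤ n × R N n) →
                   Σ[ h ∈ (ℕ → ℕ) ] StrictlyIncreasing h ×
                     (∀ k → Σ[ N ∈ ℕ ] (∀ {i} → i < k → h i < N) × R N (h k))
recursive-choice {R = R} choose = h , h< , chosen
  where
  h : ℕ → ℕ
  h zero    = proj₁ (choose zero)
  h (suc k) = proj₁ (choose (suc (h k)))

  h< : StrictlyIncreasing h
  h< = step⇒strictlyIncreasing h λ k → proj₁ (proj₂ (choose (suc (h k))))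

  below : ∀ k {i} → i < suc k → h i < suc (h k)
  below k (s≤s i≤k) with m≤n⇒m<n∨m≡n i≤k
  ... | inj₁ i<k  = s≤s (<⇒≤ (h< i<k))
  ... | inj₂ refl = ≤-refl

  chosen : ∀ k → Σ[ N ∈ ℕ ] (∀ {i} → i < k → h i < N) × R N (h k)
  chosen zero    = zero , (λ ()) , proj₂ (proj₂ (choose zero))
  chosen (suc k) = suc (h k) , below k , proj₂ (proj₂ (choose (suc (h k))))

subsequence : {P : Pred ℕ p} → InfinitelyOften P →
              Σ[ h ∈ (ℕ → ℕ) ] StrictlyIncreasing h × (∀ k → P (h k))
subsequence {P = P} often with h , h< , chosen ← recursive-choice {R = λ _ → P} often
  = h , h< , proj₂ ∘ proj₂ ∘ chosen

-- If `P` has no witness from some `N` on, every witness beyond both `N` and `M` has to come from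
-- `Q`.
infinitelyOften-∪ : ExcludedMiddle p → {P Q : Pred ℕ p} → InfinitelyOften (P ∪ Q) →
                    InfinitelyOften P ⊎ InfinitelyOften Q
infinitelyOften-∪ em {P} {Q} often with em {Σ[ N ∈ ℕ ] ¬ (Σ[ n ∈ ℕ ] N ≤ n × P n)}
... | no ¬stops       = inj₁ λ N → decidable-stable em λ ¬P → ¬stops (N , ¬P)
... | yes (N , ¬P≥N) = inj₂ later
  where
  later : InfinitelyOften Q
  later M with often (N ⊔ₙ M)
  ... | n , N⊔M≤n , inj₁ Pn = contradiction (n , ≤-trans (m≤m⊔n N M) N⊔M≤n , Pn) ¬P≥N
  ... | n , N⊔M≤n , inj₂ Qn = n , ≤-trans (m≤n⊔m N M) N⊔M≤n , Qn

-- Read `P m n` as: `n` has colour `m`; colours may overlap. Induction on the number of colours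
-- splits off the last one, and with no colours left even a single witness is absurd.
infinite-pigeonhole : ExcludedMiddle p → (P : ℕ → Pred ℕ p) → ∀ N →
                      InfinitelyOften (λ n → Σ[ m ∈ ℕ ] m < N × P m n) →
                      Σ[ m ∈ ℕ ] InfinitelyOften (P m)
infinite-pigeonhole em P zero often with often 0
... | _ , _ , _ , () , _
infinite-pigeonhole em P (suc N) often with infinitelyOften-∪ em split
  where
  split : InfinitelyOften ((λ n → Σ[ m ∈ ℕ ] m < N × P m n) ∪ P N)
  split K with often K
  ... | n , K≤n , m , s≤s m≤N , Pmn with m≤n⇒m<n∨m≡n m≤N
  ...   | inj₁ m<N  = n , K≤n , inj₁ (m , m<N , Pmn)
  ...   | inj₂ refl = n , K≤n , inj₂ Pmn
... | inj₁ below = infinite-pigeonhole em P N below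
... | inj₂ atN   = N , atN

-- Group actions and supported sequences

module _ (V : InvariantSet A ℓ) where
  open InvariantSet V
  open Group S[ A ] using (_⁻¹; inverseˡ)

  ·-injective : ∀ π {x y} → π · x ≈ π · y → x ≈ y
  ·-injective π {x} {y} eq = ≈-trans (≈-sym (cancel x))
    (≈-trans (·-cong {π = π ⁻¹} (λ _ → refl) eq) (cancel y))
    where
    cancel : ∀ z → π ⁻¹ · π · z ≈ z
    cancel z = ≈-trans (≈-sym (·-∘ (π ⁻¹) π z))
      (≈-trans (·-cong (inverseˡ π) ≈-refl) (·-id z))

-- This is an injection from `ℕ` to `X` in unpacked form: since atoms act trivially on `ℕ`,
-- equivariance under `Fix support` says precisely that `support` supports each term.
record SupportedSequence {A : Set a} {V : InvariantSet A ℓ} (X : Subset V) : Set (a ⊔ ℓ) where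
  open InvariantSet V
  field
    at        : ℕ → Carrier
    member    : ∀ n → Subset.mem X (at n)
    injective : ∀ {m n} → at m ≈ at n → m ≡ n
    support   : List A
    supported : ∀ n → Supports support (at n)

module _ {A : Set a} {V : InvariantSet A ℓ} (X : Subset V) where
  open InvariantSet V
  open Subset X using (mem; respects)

  ·-closed : ((S , _) : FinitelySupported X) → ∀ {π} → Fix S π → ∀ {x} → mem x → mem (π · x)
  ·-closed (S , stable) fix x∈X = proj₁ (stable _ fix) (_ , x∈X , ≈-refl)

  fsInjection⇒sequence : FSInjection (whole (ℕᵢ A)) X → SupportedSequence X
  fsInjection⇒sequence (f , S , equivariant) = record
    { at        = λ n → proj₁ (Injection.to f (n , tt))
    ; member    = λ n → proj₂ (Injection.to f (n , tt))
    ; injective = Injection.injective f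
    ; support   = S
    ; supported = λ n π fix → ≈-sym (proj₂ (proj₂ (equivariant π fix)) n tt)
    }

  sequence⇒fsInjection : FinitelySupported X → SupportedSequence X → FSInjection (whole (ℕᵢ A)) X
  sequence⇒fsInjection fsX@(T , _) s =
    record
      { to        = λ (n , _) → at n , member n
      ; cong      = λ { refl → ≈-refl }
      ; injective = injective
      } ,
    -- A support of a function must also keep the codomain stable, hence the support `T` of `X` is
    -- joined in.
    support ++ T , λ π fix →
      (λ _ → tt) ,
      ·-closed fsX (Fix-++ʳ support {π = π} fix) ,
      λ n _ → ≈-sym (supported n π (Fix-++ˡ {π = π} fix))
    where open SupportedSequence s

  dedekindInfinite⇒sequence : ExcludedMiddle ℓ → FSDedekindInfinite X → SupportedSequence X
  dedekindInfinite⇒sequence em (Z , _ , (Z⊆X , X⊈Z) , f , S , equivariant)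
    -- Properness is only the negation of an inclusion; excluded middle extracts from it a point of
    -- `X` outside `Z`, the seed of the iteration.
    with em {Σ[ x ∈ Carrier ] mem x × ¬ Subset.mem Z x}
  ... | no none = contradiction
        (λ {x} x∈X → decidable-stable em λ x∉Z → none (x , x∈X , x∉Z)) X⊈Z
  ... | yes (x , x∈X , x∉Z) = record
    { at        = proj₁ ∘ iter
    ; member    = proj₂ ∘ iter
    ; injective = iter-injective _ _
    ; support   = S ++ T
    ; supported = λ n π fix →
        iter-supported π (Fix-++ˡ {π = π} fix) (x-supported π (Fix-++ʳ S {π = π} fix)) n
    }
    where
    open Bijection f using (to) renaming (cong to to-cong; injective to to-injective)

    T = proj₁ (finiteSupport x)
    x-supported = proj₂ (finiteSupport x)

    iter : ℕ → Σ[ y ∈ Carrier ] mem y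
    iter zero    = x , x∈X
    iter (suc n) = proj₁ (to (iter n)) , Z⊆X (proj₂ (to (iter n)))

    x≉iter-suc : ∀ n → ¬ x ≈ proj₁ (iter (suc n))
    x≉iter-suc n eq = x∉Z (Subset.respects Z (≈-sym eq) (proj₂ (to (iter n))))

    -- Cancelling `f` on both sides ends with `x` against a later iterate; the latter lies in `Z`,
    -- the former does not.
    iter-injective : ∀ m n → proj₁ (iter m) ≈ proj₁ (iter n) → m ≡ n
    iter-injective zero    zero    _  = refl
    iter-injective zero    (suc n) eq = contradiction eq (x≉iter-suc n)
    iter-injective (suc m) zero    eq = contradiction (≈-sym eq) (x≉iter-suc m)
    iter-injective (suc m) (suc n) eq = cong suc (iter-injective m n (to-injective eq))

    iter-supported : ∀ π → Fix S π → π · x ≈ x → ∀ n → π · proj₁ (iter n) ≈ proj₁ (iter n)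
    iter-supported π fix πx≈x zero    = πx≈x
    iter-supported π fix πx≈x (suc n) = ≈-trans
      (≈-sym (proj₂ (proj₂ (equivariant π fix)) _ (proj₂ (iter n))))
      (to-cong (iter-supported π fix πx≈x n))

  -- The shift along a sequence

  module _ (em : ExcludedMiddle ℓ) (fsX : FinitelySupported X) (s : SupportedSequence X) where
    open SupportedSequence s

    private
      T = proj₁ fsX

      Hit : Pred Carrier ℓ
      Hit x = Σ[ n ∈ ℕ ] x ≈ at n

      shift : Carrier → Carrier
      shift x with em {Hit x}
      ... | yes (n , _) = at (suc n)
      ... | no  _       = x

      -- The index that `em` returns is `n` itself, because distinct indices give distinct terms.
      shift-hit : ∀ {x n} → x ≈ at n → shift x ≈ at (suc n)
      shift-hit {x} {n} x≈n with em {Hit x}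
      ... | yes (m , x≈m) with refl ← injective (≈-trans (≈-sym x≈m) x≈n) = ≈-refl
      ... | no  ¬hit      = contradiction (n , x≈n) ¬hit

      shift-miss : ∀ {x} → ¬ Hit x → shift x ≈ x
      shift-miss {x} ¬hit with em {Hit x}
      ... | yes hit = contradiction hit ¬hit
      ... | no  _   = ≈-refl

      Hit-resp : ∀ {x y} → x ≈ y → Hit x → Hit y
      Hit-resp x≈y (n , x≈n) = n , ≈-trans (≈-sym x≈y) x≈n

      shift-cong : ∀ {x y} → x ≈ y → shift x ≈ shift y
      shift-cong {x} x≈y with em {Hit x}
      ... | yes (n , x≈n) = ≈-sym (shift-hit (≈-trans (≈-sym x≈y) x≈n))
      ... | no  ¬hit      = ≈-trans x≈y (≈-sym (shift-miss (¬hit ∘ Hit-resp (≈-sym x≈y))))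

      -- In the mixed cases the point off the sequence would equal a successor term, so it would be
      -- on the sequence after all.
      shift-injective : ∀ {x y} → shift x ≈ shift y → x ≈ y
      shift-injective {x} {y} eq with em {Hit x} | em {Hit y}
      ... | yes (m , x≈m) | yes (n , y≈n) with refl ← suc-injective (injective eq)
                                          = ≈-trans x≈m (≈-sym y≈n)
      ... | yes (m , _)   | no ¬hit       = contradiction (suc m , ≈-sym eq) ¬hit
      ... | no ¬hit       | yes (n , _)   = contradiction (suc n , eq) ¬hit
      ... | no _          | no _          = eq

      -- This is the image of `X` under `shift`, as `shift-tail` and `unshift` verify.
      tail : Subset V
      tail = record
        { mem      = λ x → mem x × ¬ x ≈ at 0
        ; respects = λ x≈y (x∈X , x≉0) → respects x≈y x∈X , x≉0 ∘ ≈-trans x≈y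
        }

      shift-tail : ∀ {x} → mem x → Subset.mem tail (shift x)
      shift-tail {x} x∈X with em {Hit x}
      ... | yes (n , _) = member (suc n) , λ eq → contradiction (injective eq) λ ()
      ... | no  ¬hit    = x∈X , λ eq → ¬hit (0 , eq)

      unshift : ∀ {y} → Subset.mem tail y → Σ[ x ∈ Carrier ] mem x × shift x ≈ y
      unshift {y} (y∈X , y≉0) with em {Hit y}
      ... | yes (zero  , y≈0) = contradiction y≈0 y≉0
      ... | yes (suc n , y≈n) = at n , member n , ≈-trans (shift-hit ≈-refl) (≈-sym y≈n)
      ... | no  ¬hit          = y , y∈X , shift-miss ¬hit

      -- Since `π` fixes `at n`, it can be cancelled on both sides. Used contrapositively: `π` moves
      -- no point onto a term that the point did not already equal.
      ·-hit⁻¹ : ∀ {π} → Fix support π → ∀ {x n} → π · x ≈ at n → x ≈ at n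
      ·-hit⁻¹ {π} fix {n = n} eq = ·-injective V π (≈-trans eq (≈-sym (supported n π fix)))

      shift-equivariant : ∀ {π} → Fix support π → ∀ x → shift (π · x) ≈ π · shift x
      shift-equivariant {π} fix x with em {Hit x}
      ... | yes (n , x≈n) = ≈-trans
            (shift-hit (≈-trans (·-cong {π = π} (λ _ → refl) x≈n) (supported n π fix)))
            (≈-sym (supported (suc n) π fix))
      ... | no  ¬hit      = shift-miss λ (n , eq) → ¬hit (n , ·-hit⁻¹ {π} fix eq)

      ·-tail : ∀ {π} → Fix (support ++ T) π → ∀ {x} → Subset.mem tail x → Subset.mem tail (π · x)
      ·-tail {π} fix (x∈X , x≉0) =
        ·-closed fsX (Fix-++ʳ support {π = π} fix) x∈X ,
        x≉0 ∘ ·-hit⁻¹ {π} (Fix-++ˡ {π = π} fix)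

      tail-finitelySupported : FinitelySupported tail
      tail-finitelySupported = support ++ T , λ π fix →
        (λ (x , x∈tail , y≈πx) →
          Subset.respects tail (≈-sym y≈πx) (·-tail {π} fix x∈tail)) ,
        -- The preimage `x` of `y` under `π` comes from the stability of `X`; were it `at 0`, which
        -- `π` fixes, then `y` would be `at 0` too.
        λ (y∈X , y≉0) →
          let (x , x∈X , y≈πx) = proj₂ (proj₂ fsX π (Fix-++ʳ support {π = π} fix)) y∈X
          in x , (x∈X , λ x≈0 → y≉0 (≈-trans y≈πx
                   (≈-trans (·-cong {π = π} (λ _ → refl) x≈0)
                            (supported 0 π (Fix-++ˡ {π = π} fix))))) , y≈πx

    sequence⇒dedekindInfinite : FSDedekindInfinite X
    sequence⇒dedekindInfinite =
      tail ,
      tail-finitelySupported ,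
      (proj₁ , λ X⊆tail → proj₂ (X⊆tail (member 0)) ≈-refl) ,
      record
        { to        = λ (x , x∈X) → shift x , shift-tail x∈X
        ; cong      = shift-cong
        ; bijective = shift-injective , λ (y , y∈tail) →
            let (x , x∈X , shift-x≈y) = unshift y∈tail
            in (x , x∈X) , λ z≈x → ≈-trans (shift-cong z≈x) shift-x≈y
        } ,
      support ++ T , λ π fix →
        ·-closed fsX (Fix-++ʳ support {π = π} fix) ,
        ·-tail {π} fix ,
        λ x _ → shift-equivariant {π} (Fix-++ˡ {π = π} fix) x

  -- The range of a sequence

  module _ (s : SupportedSequence X) where
    open SupportedSequence s

    range : Subset V
    range = record
      { mem      = λ x → Σ[ n ∈ ℕ ] x ≈ at n
      ; respects = λ x≈y (n , x≈n) → n , ≈-trans (≈-sym x≈y) x≈n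
      }

    range⊆ : Subset.mem range ⊆ mem
    range⊆ (n , x≈n) = respects (≈-sym x≈n) (member n)

    range-uniformlySupported : UniformlySupported range
    range-uniformlySupported = support , λ (n , x≈n) π fix →
      ≈-trans (·-cong {π = π} (λ _ → refl) x≈n) (≈-trans (supported n π fix) (≈-sym x≈n))

    range-infinite : Infinite setoidOf (Subset.mem range)
    range-infinite (xs , enumerates) =
      -- Among the first `suc (length xs)` terms two occupy the same position of the list `xs`;
      -- `≤-refl` proves that there are more terms than positions.
      let (i , j , i<j , eq) = Fin.pigeonhole ≤-refl (index ∘ listed ∘ toℕ)
      in <⇒≢ i<j (injective (SetoidMembershipₚ.index-injective setoidOf
           (listed (toℕ i)) (listed (toℕ j)) eq))
      where
      open SetoidMembership setoidOf renaming (_∈_ to _∈ₛ_)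

      listed : ∀ n → at n ∈ₛ xs
      listed n = Equivalence.to (enumerates (at n)) (n , ≈-refl)

-- Products and disjoint sums

module _ {A : Set a} {V W : InvariantSet A ℓ} {X : Subset V} {Y : Subset W} where
  private
    module V = InvariantSet V
    module W = InvariantSet W
    module V⊎W = InvariantSet (V ⊎ᵢ W)

  module _ (em : ExcludedMiddle ℓ) (s : SupportedSequence (X ×ₛᵤᵦ Y)) where
    open SupportedSequence s

    private
      x = proj₁ ∘ at
      y = proj₂ ∘ at

      Repeats : ℕ → Pred ℕ ℓ
      Repeats N n = Σ[ m ∈ ℕ ] m < N × x m V.≈ x n

      -- However many terms are discarded, a first coordinate not seen among them remains, so
      -- pairwise distinct ones can be picked successively.
      unbounded⇒sequence : (∀ N → Σ[ n ∈ ℕ ] ¬ Repeats N n) → SupportedSequence X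
      unbounded⇒sequence new = let (h , _ , chosen) = recursive-choice choose in record
        { at        = x ∘ h
        ; member    = proj₁ ∘ member ∘ h
        ; injective = x∘h-injective h chosen
        ; support   = support
        ; supported = λ n π fix → proj₁ (supported (h n) π fix)
        }
        where
        choose : ∀ N → Σ[ n ∈ ℕ ] N ≤ n × ¬ Repeats N n
        choose N with n , ¬repeats ← new N =
          -- An index below `N` would repeat its own first coordinate, so the new index is at least
          -- `N`.
          n , ≮⇒≥ (λ n<N → ¬repeats (n , n<N , V.≈-refl)) , ¬repeats

        x∘h-injective : ∀ h →
          (∀ k → Σ[ N ∈ ℕ ] (∀ {i} → i < k → h i < N) × ¬ Repeats N (h k)) →
          ∀ {i j} → x (h i) V.≈ x (h j) → i ≡ j
        x∘h-injective h chosen {i} {j} eq with <-cmp i j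
        -- The later of two chosen terms was picked with a bound above the earlier one, hence does
        -- not repeat its first coordinate.
        ... | tri≈ _ i≡j _ = i≡j
        ... | tri< i<j _ _ = let (_ , below , ¬repeats) = chosen j in
              contradiction (h i , below i<j , eq) ¬repeats
        ... | tri> _ _ j<i = let (_ , below , ¬repeats) = chosen i in
              contradiction (h j , below j<i , V.≈-sym eq) ¬repeats

      -- The first `N` terms exhaust the first coordinates, so one value recurs infinitely often.
      -- Along that subsequence the pairs are distinct but agree in the first coordinate, so their
      -- second coordinates are distinct.
      bounded⇒sequence : ∀ N → (∀ n → Repeats N n) → SupportedSequence Y
      bounded⇒sequence N repeats
        with m , often ← infinite-pigeonhole em (λ m n → x m V.≈ x n) N
                           (λ n → n , ≤-refl , repeats n)
        with h , h< , xₘ≈ ← subsequence often = record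
        { at        = y ∘ h
        ; member    = proj₂ ∘ member ∘ h
        ; injective = λ {i} {j} eq → strictlyIncreasing⇒injective h h<
            (injective (V.≈-trans (V.≈-sym (xₘ≈ i)) (xₘ≈ j) , eq))
        ; support   = support
        ; supported = λ n π fix → proj₂ (supported (h n) π fix)
        }

    sequence-× : SupportedSequence X ⊎ SupportedSequence Y
    sequence-× with em {Σ[ N ∈ ℕ ] (∀ n → Repeats N n)}
    ... | yes (N , repeats) = inj₂ (bounded⇒sequence N repeats)
    ... | no unbounded      = inj₁ (unbounded⇒sequence λ N → decidable-stable em λ none →
            unbounded (N , λ n → decidable-stable em λ ¬repeats → none (n , ¬repeats)))

  module _ (em : ExcludedMiddle ℓ) (s : SupportedSequence (X ⊎ₛᵤᵦ Y)) where
    open SupportedSequence s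

    private
      -- The equation is kept with the component so that membership, injectivity and support can be
      -- transported along it.
      sides : (z : V⊎W.Carrier) →
              (Σ[ v ∈ V.Carrier ] z ≡ inj₁ v) ⊎ (Σ[ w ∈ W.Carrier ] z ≡ inj₂ w)
      sides (inj₁ v) = inj₁ (v , refl)
      sides (inj₂ w) = inj₂ (w , refl)

      left : InfinitelyOften (λ n → Σ[ v ∈ V.Carrier ] at n ≡ inj₁ v) → SupportedSequence X
      left often with h , h< , v ← subsequence often = record
        { at        = proj₁ ∘ v
        ; member    = λ n → subst (Subset.mem (X ⊎ₛᵤᵦ Y)) (proj₂ (v n)) (member (h n))
        ; injective = λ {i} {j} eq → strictlyIncreasing⇒injective h h< (injective
            (subst₂ V⊎W._≈_ (sym (proj₂ (v i))) (sym (proj₂ (v j))) (inj₁ eq)))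
        ; support   = support
        ; supported = λ n π fix → drop-inj₁
            (subst (V⊎W.Supports support) (proj₂ (v n)) (supported (h n)) π fix)
        }

      right : InfinitelyOften (λ n → Σ[ w ∈ W.Carrier ] at n ≡ inj₂ w) → SupportedSequence Y
      right often with h , h< , w ← subsequence often = record
        { at        = proj₁ ∘ w
        ; member    = λ n → subst (Subset.mem (X ⊎ₛᵤᵦ Y)) (proj₂ (w n)) (member (h n))
        ; injective = λ {i} {j} eq → strictlyIncreasing⇒injective h h< (injective
            (subst₂ V⊎W._≈_ (sym (proj₂ (w i))) (sym (proj₂ (w j))) (inj₂ eq)))
        ; support   = support
        ; supported = λ n π fix → drop-inj₂
            (subst (V⊎W.Supports support) (proj₂ (w n)) (supported (h n)) π fix)
        }

    sequence-⊎ : SupportedSequence X ⊎ SupportedSequence Y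
    sequence-⊎ = Sum.map left right
      (infinitelyOften-∪ em λ N → N , ≤-refl , sides (at N))

-- Deducing the four claims from sequences

mainTheorem9 : ∀ {a ℓ} → ExcludedMiddle (a ⊔ ℓ) →
    (A : Set a) → Infinite (setoid A) U →
    (V W : InvariantSet A ℓ) (X : Subset V) (Y : Subset W) →
    FinitelySupported X → FinitelySupported Y →
    (FSDedekindInfinite X ⇔ FSInjection (whole (ℕᵢ A)) X)
    × (¬ (Σ[ Z ∈ Subset V ] Subset.mem Z ⊆ Subset.mem X × UniformlySupported Z
    × Infinite (InvariantSet.setoidOf V) (Subset.mem Z))
    → ¬ FSDedekindInfinite X)
    × (¬ FSDedekindInfinite X → ¬ FSDedekindInfinite Y → ¬ FSDedekindInfinite (X ×ₛᵤᵦ Y))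
    × (¬ FSDedekindInfinite X → ¬ FSDedekindInfinite Y → ¬ FSDedekindInfinite (X ⊎ₛᵤᵦ Y))
mainTheorem9 {a} {ℓ} em⁺ A _ V W X Y fsX fsY =
  mk⇔ (sequence⇒fsInjection X fsX ∘ dedekindInfinite⇒sequence X em)
      (X-infinite ∘ fsInjection⇒sequence X) ,
  (λ none X-inf → let s = dedekindInfinite⇒sequence X em X-inf in
    none (range X s , range⊆ X s , range-uniformlySupported X s , range-infinite X s)) ,
  (λ ¬X ¬Y → [ ¬X ∘ X-infinite , ¬Y ∘ Y-infinite ] ∘ sequence-× em
               ∘ dedekindInfinite⇒sequence (X ×ₛᵤᵦ Y) em) ,
  (λ ¬X ¬Y → [ ¬X ∘ X-infinite , ¬Y ∘ Y-infinite ] ∘ sequence-⊎ em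
               ∘ dedekindInfinite⇒sequence (X ⊎ₛᵤᵦ Y) em)
  where
  em : ExcludedMiddle ℓ
  em = lower-em a em⁺

  -- The way back from sequences is taken in `X` and `Y`, where `fsX` and `fsY` make the
  -- omitted-point subset finitely supported.
  X-infinite : SupportedSequence X → FSDedekindInfinite X
  X-infinite = sequence⇒dedekindInfinite X em fsX

  Y-infinite : SupportedSequence Y → FSDedekindInfinite Y
  Y-infinite = sequence⇒dedekindInfinite Y em fsY
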